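{- Let $A \subseteq \omega$ be a computably enumerable set. If $A$ is $c_1$-complete then $A$ is $c_{1,N}$-complete.
   Context: $\omega$ is the set of natural numbers and $D_u$ denotes the finite set with canonical index $u$. For sets $X, Y \subseteq \omega$: - A $c$-reduction from $X$ to $Y$ is a (total) computable function $f$ such that for all $x$: $x \in X \iff D_{f(x)} \subseteq Y$. - $X \le_{c_1} Y$ if there is a $c_1$-reduction from $X$ to $Y$, i.e. a $c$-reduction $f$ from $X$ to $Y$ such that $x \neq y$ implies $D_{f(x)} \cap D_{f(y)} = \emptyset$. - $X \le_{c_{1,N}} Y$ if there is a $c_1$-reduction $f$ from $X$ to $Y$ such that the set $R_f = \bigcup_{x \in \omega} D_{f(x)}$ is computable. For a reducibility $r$, a computably enumerable (c.e.) set $A$ is $r$-complete if $B \le_r A$ for every c.e. set $B$. -}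

module Defs where

open import Data.Fin.Base using (Fin)
open import Data.Nat.Base using (ℕ; zero; suc; _<_; _^_)
open import Data.Nat.DivMod using (_/_; _%_)
open import Data.Nat.Properties using (m^n≢0)
open import Data.Product.Base using (_×_; ∃; ∃-syntax)
open import Data.Sum.Base using (_⊎_)
open import Data.Vec.Base using (Vec; []; _∷_; lookup)
open import Data.Vec.Relation.Binary.Pointwise.Inductive using (Pointwise)
open import Function.Bundles using (_⇔_)
open import Level using (0ℓ)
open import Relation.Binary.PropositionalEquality.Core using (_≡_; _≢_)
open import Relation.Unary using (Pred; _∈_; _∉_; _⊆_; _∩_; Empty; ⋃)

-- Programs for the n-ary partial recursive (μ-recursive) functions.
data Rec : ℕ → Set where
  zeroᶠ : ∀ {n} → Rec n
  sucᶠ  : Rec 1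
  proj  : ∀ {n} → Fin n → Rec n
  comp  : ∀ {m n} → Rec m → Vec (Rec n) m → Rec n
  prim  : ∀ {n} → Rec n → Rec (suc (suc n)) → Rec (suc n)
  μ     : ∀ {n} → Rec (suc n) → Rec n

infix 4 _⟨_⟩⇓_

-- e ⟨ xs ⟩⇓ y : the program e halts on input xs with output y.
-- The recursion variable of prim and the search variable of μ are the first
-- argument; the step function of prim receives k, the value at k, and the
-- parameters, in that order.
data _⟨_⟩⇓_ : ∀ {n} → Rec n → Vec ℕ n → ℕ → Set where
  ⇓zero : ∀ {n} {xs : Vec ℕ n} → zeroᶠ ⟨ xs ⟩⇓ 0
  ⇓suc  : ∀ {x} → sucᶠ ⟨ x ∷ [] ⟩⇓ suc x
  ⇓proj : ∀ {n} {i : Fin n} {xs : Vec ℕ n} → proj i ⟨ xs ⟩⇓ lookup xs i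
  ⇓comp : ∀ {m n} {f : Rec m} {gs : Vec (Rec n) m} {xs : Vec ℕ n} {ys : Vec ℕ m} {z} →
          Pointwise (λ g y → g ⟨ xs ⟩⇓ y) gs ys → f ⟨ ys ⟩⇓ z →
          comp f gs ⟨ xs ⟩⇓ z
  ⇓prim-zero : ∀ {n} {f : Rec n} {g : Rec (suc (suc n))} {xs : Vec ℕ n} {y} →
               f ⟨ xs ⟩⇓ y → prim f g ⟨ 0 ∷ xs ⟩⇓ y
  ⇓prim-suc  : ∀ {n} {f : Rec n} {g : Rec (suc (suc n))} {xs : Vec ℕ n} {k y z} →
               prim f g ⟨ k ∷ xs ⟩⇓ y → g ⟨ k ∷ y ∷ xs ⟩⇓ z →
               prim f g ⟨ suc k ∷ xs ⟩⇓ z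
  -- f must be defined, with a nonzero value, at every argument below the zero found.
  ⇓μ : ∀ {n} {f : Rec (suc n)} {xs : Vec ℕ n} {z} →
       f ⟨ z ∷ xs ⟩⇓ 0 → (∀ {i} → i < z → ∃[ k ] f ⟨ i ∷ xs ⟩⇓ suc k) →
       μ f ⟨ xs ⟩⇓ z

ComputableFunction : (ℕ → ℕ) → Set
ComputableFunction f = ∃[ e ] ∀ x → e ⟨ x ∷ [] ⟩⇓ f x

ComputableSet : Pred ℕ 0ℓ → Set
ComputableSet X = ∃[ χ ] ComputableFunction χ ×
  (∀ x → (x ∈ X × χ x ≡ 1) ⊎ (x ∉ X × χ x ≡ 0))

-- X is the domain of a partial recursive function.
CE : Pred ℕ 0ℓ → Set
CE X = ∃[ e ] ∀ x → x ∈ X ⇔ (∃[ y ] e ⟨ x ∷ [] ⟩⇓ y)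

-- The finite set with canonical index u, i.e. the set with u = Σ_{x ∈ D u} 2^x:
-- x belongs to it iff the binary digit of u at position x is 1.
D : ℕ → Pred ℕ 0ℓ
D u x = (_/_ u (2 ^ x) {{m^n≢0 2 x}}) % 2 ≡ 1

IsCReduction : Pred ℕ 0ℓ → Pred ℕ 0ℓ → (ℕ → ℕ) → Set
IsCReduction X Y f = ComputableFunction f × (∀ x → x ∈ X ⇔ D (f x) ⊆ Y)

IsC₁Reduction : Pred ℕ 0ℓ → Pred ℕ 0ℓ → (ℕ → ℕ) → Set
IsC₁Reduction X Y f =
  IsCReduction X Y f × (∀ x y → x ≢ y → Empty (D (f x) ∩ D (f y)))

infix 4 _≤c₁_ _≤c₁N_

_≤c₁_ : Pred ℕ 0ℓ → Pred ℕ 0ℓ → Set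
X ≤c₁ Y = ∃[ f ] IsC₁Reduction X Y f

_≤c₁N_ : Pred ℕ 0ℓ → Pred ℕ 0ℓ → Set
X ≤c₁N Y = ∃[ f ] IsC₁Reduction X Y f × ComputableSet (⋃[ x ∶ ℕ ] D (f x))

Complete : (Pred ℕ 0ℓ → Pred ℕ 0ℓ → Set) → Pred ℕ 0ℓ → Set₁
Complete _≤ᵣ_ A = ∀ (B : Pred ℕ 0ℓ) → CE B → B ≤ᵣ A

{-# OPTIONS --safe #-}

-- The c₁-completeness of A is applied not to B but to its cylinder
-- B′ = { code x n ∣ x ∈ B }.  If h reduces B′ to A, then the x + 1 pairwise
-- disjoint sets D (h (code x n)), n ≤ x, cannot all meet {0, …, x − 1}, so one
-- can search for an n for which D (h (code x n)) has no element below x.  Taking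
-- it as the image of x gives a c₁-reduction f of B in which y ∈ D (f x) forces
-- x ≤ y, so that membership of y in the union is a bounded search.
module Submission where

open import Defs
open import Data.Empty using (⊥; ⊥-elim)
open import Data.Fin.Base using (Fin; zero; suc; toℕ; fromℕ<)
open import Data.Fin.Properties using (any?; pigeonhole; toℕ-fromℕ<; toℕ<n)
open import Data.Nat.Base
open import Data.Nat.DivMod
open import Data.Nat.Properties
open import Data.Product.Base using (_×_; _,_; ∃; ∃-syntax; Σ-syntax; proj₁; proj₂)
open import Data.Sum.Base using (_⊎_; inj₁; inj₂)
open import Data.Vec.Base using (Vec; []; _∷_; lookup; tabulate; tail)
open import Data.Vec.Relation.Binary.Pointwise.Inductive
  using (Pointwise; []; _∷_; tabulate⁺)
open import Data.Vec.Properties using (tabulate∘lookup; tabulate-cong)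
open import Function.Base using (_∘_; id)
open import Function.Bundles using (_⇔_; mk⇔; module Equivalence)
open import Level using (0ℓ)
open import Relation.Binary.Definitions using (tri<; tri≈; tri>)
open import Relation.Binary.PropositionalEquality
open import Relation.Nullary using (yes; no; contradiction)
open import Relation.Unary using (Pred; _∈_; _∉_; _⊆_; _∩_; Empty; ⋃)

-- Determinism of evaluation

private
  variable
    m n : ℕ

⇓-deterministic : ∀ {e : Rec n} {xs y z} → e ⟨ xs ⟩⇓ y → e ⟨ xs ⟩⇓ z → y ≡ z
⇓*-deterministic : ∀ {gs : Vec (Rec n) m} {xs ys zs} →
                   Pointwise (λ g y → g ⟨ xs ⟩⇓ y) gs ys →
                   Pointwise (λ g z → g ⟨ xs ⟩⇓ z) gs zs → ys ≡ zs

⇓-deterministic ⇓zero ⇓zero = refl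
⇓-deterministic ⇓suc ⇓suc = refl
⇓-deterministic ⇓proj ⇓proj = refl
⇓-deterministic (⇓comp ps p) (⇓comp qs q) with refl ← ⇓*-deterministic ps qs =
  ⇓-deterministic p q
⇓-deterministic (⇓prim-zero p) (⇓prim-zero q) = ⇓-deterministic p q
⇓-deterministic (⇓prim-suc p p′) (⇓prim-suc q q′) with refl ← ⇓-deterministic p q =
  ⇓-deterministic p′ q′
-- If the two zeros differed, the smaller would be an argument at which the search for the larger
-- recorded a nonzero value.
⇓-deterministic (⇓μ {z = y} p ps) (⇓μ {z = z} q qs) with <-cmp y z
... | tri≈ _ y≡z _ = y≡z
... | tri< y<z _ _ = contradiction (⇓-deterministic p (proj₂ (qs y<z))) 0≢1+n
... | tri> _ _ z<y = contradiction (⇓-deterministic (proj₂ (ps z<y)) q) 1+n≢0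

⇓*-deterministic [] [] = refl
⇓*-deterministic (p ∷ ps) (q ∷ qs) =
  cong₂ _∷_ (⇓-deterministic p q) (⇓*-deterministic ps qs)

-- Closure properties of computable functions

Computable : (Vec ℕ n → ℕ) → Set
Computable F = ∃[ e ] ∀ xs → e ⟨ xs ⟩⇓ F xs

ComputableMap : (Vec ℕ n → Vec ℕ m) → Set
ComputableMap {n} {m} G = Σ[ gs ∈ Vec (Rec n) m ] ∀ xs → Pointwise (λ g y → g ⟨ xs ⟩⇓ y) gs (G xs)

ComputableFunction₂ : (ℕ → ℕ → ℕ) → Set
ComputableFunction₂ f = ∃[ e ] ∀ x y → e ⟨ x ∷ y ∷ [] ⟩⇓ f x y

unary : {F : Vec ℕ 1 → ℕ} → Computable F → ComputableFunction (λ x → F (x ∷ []))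
unary (e , p) = e , λ x → p (x ∷ [])

binary : {F : Vec ℕ 2 → ℕ} → Computable F → ComputableFunction₂ (λ x y → F (x ∷ y ∷ []))
binary (e , p) = e , λ x y → p (x ∷ y ∷ [])

var : (i : Fin n) → Computable (λ xs → lookup xs i)
var i = proj i , λ _ → ⇓proj

computable-0 : Computable {n} (λ _ → 0)
computable-0 = zeroᶠ , λ _ → ⇓zero

suc-computable : ComputableFunction suc
suc-computable = sucᶠ , λ _ → ⇓suc

infixr 5 _∷ᶜ_

_∷ᶜ_ : {F : Vec ℕ n → ℕ} {G : Vec ℕ n → Vec ℕ m} →
       Computable F → ComputableMap G → ComputableMap (λ xs → F xs ∷ G xs)
(f , p) ∷ᶜ (gs , ps) = f ∷ gs , λ xs → p xs ∷ ps xs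

reindexing-computable : (ρ : Fin m → Fin n) {G : Vec ℕ n → Vec ℕ m} →
                        (∀ xs i → lookup xs (ρ i) ≡ lookup (G xs) i) → ComputableMap G
reindexing-computable ρ {G} eq = tabulate (proj ∘ ρ) , λ xs →
  subst (Pointwise _ _)
    (trans (tabulate-cong (eq xs)) (tabulate∘lookup (G xs)))
    (tabulate⁺ λ i → ⇓proj)

∘-computable : {F : Vec ℕ m → ℕ} {G : Vec ℕ n → Vec ℕ m} →
               Computable F → ComputableMap G → Computable (F ∘ G)
∘-computable {G = G} (f , p) (gs , ps) = comp f gs , λ xs → ⇓comp (ps xs) (p (G xs))

infix 9 _⟪_⟫ _⟪_∣_⟫

_⟪_⟫ : {f : ℕ → ℕ} {F : Vec ℕ n → ℕ} →
       ComputableFunction f → Computable F → Computable (λ xs → f (F xs))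
(f , p) ⟪ g , q ⟫ = comp f (g ∷ []) , λ xs → ⇓comp (q xs ∷ []) (p _)

_⟪_∣_⟫ : {f : ℕ → ℕ → ℕ} {F G : Vec ℕ n → ℕ} → ComputableFunction₂ f →
         Computable F → Computable G → Computable (λ xs → f (F xs) (G xs))
(f , p) ⟪ (g , q) ∣ (h , r) ⟫ =
  comp f (g ∷ h ∷ []) , λ xs → ⇓comp (q xs ∷ r xs ∷ []) (p _ _)

-- `F` enters only through its recursion equations, so it may be defined independently of any
-- program. The recursion depth is a computable `k` of the parameters, which are also passed on
-- unchanged; recursion can thus run on any variable.
prim-computable :
  (F : ℕ → Vec ℕ n → ℕ) {z k : Vec ℕ n → ℕ} {s : Vec ℕ (2 + n) → ℕ} →
  Computable z → Computable s →
  (∀ xs → z xs ≡ F 0 xs) → (∀ i xs → s (i ∷ F i xs ∷ xs) ≡ F (suc i) xs) →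
  Computable k → Computable (λ xs → F (k xs) xs)
prim-computable {n} F {k = k} (z , pz) (s , ps) eqz eqs (c , pc)
  with ids , pids ← reindexing-computable {n} id {id} (λ _ _ → refl) =
  comp (prim z s) (c ∷ ids) , λ xs → ⇓comp (pc xs ∷ pids xs) (run (k xs) xs)
  where
  run : ∀ i xs → prim z s ⟨ i ∷ xs ⟩⇓ F i xs
  run zero xs = ⇓prim-zero (subst (z ⟨ xs ⟩⇓_) (eqz xs) (pz xs))
  run (suc i) xs = ⇓prim-suc (run i xs) (subst (s ⟨ _ ⟩⇓_) (eqs i xs) (ps _))

-- Unbounded search

IsLeastZero : (ℕ → ℕ) → ℕ → Set
IsLeastZero p k = p k ≡ 0 × (∀ {i} → i < k → p i ≢ 0)

least-zero : ∀ p b → p b ≡ 0 → ∃ (IsLeastZero p)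
least-zero p b pb≡0 with p 0 ≟ 0
least-zero p b       pb≡0 | yes p0≡0 = 0 , p0≡0 , λ ()
least-zero p zero    pb≡0 | no p0≢0 = contradiction pb≡0 p0≢0
least-zero p (suc b) pb≡0 | no p0≢0 with least-zero (p ∘ suc) b pb≡0
... | k , pk≡0 , below = suc k , pk≡0 , below-suc
  where
  below-suc : ∀ {i} → i < suc k → p i ≢ 0
  below-suc {zero}  _         = p0≢0
  below-suc {suc i} (s≤s i<k) = below i<k

least-zero-unique : ∀ {p k l} → IsLeastZero p k → IsLeastZero p l → k ≡ l
least-zero-unique {k = k} {l} (pk , belowk) (pl , belowl) with <-cmp k l
... | tri≈ _ k≡l _ = k≡l
... | tri< k<l _ _ = contradiction pk (belowl k<l)
... | tri> _ _ l<k = contradiction pl (belowk l<k)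

μ-computable : {F : Vec ℕ (suc n) → ℕ} {k : Vec ℕ n → ℕ} → Computable F →
               (∀ xs → IsLeastZero (λ i → F (i ∷ xs)) (k xs)) → Computable k
μ-computable {F = F} (f , p) least = μ f , λ xs → ⇓μ
  (subst (f ⟨ _ ⟩⇓_) (proj₁ (least xs)) (p _))
  -- `⇓μ` wants each earlier value in the form `suc _`; being nonzero, it is the successor of its
  -- predecessor.
  λ {i} i<k → pred (F (i ∷ xs)) ,
    subst (f ⟨ _ ⟩⇓_) (sym (suc-pred _ {{≢-nonZero (proj₂ (least xs) i<k)}})) (p _)

-- Arithmetic and binary digits

+-computable : ComputableFunction₂ _+_
+-computable = binary (prim-computable (λ k xs → k + lookup xs (suc zero))
  (var (suc zero)) (suc-computable ⟪ var (suc zero) ⟫)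
  (λ _ → refl) (λ _ _ → refl) (var zero))

pred-computable : ComputableFunction pred
pred-computable = unary (prim-computable (λ k _ → pred k)
  computable-0 (var zero) (λ _ → refl) (λ _ _ → refl) (var zero))

∸-computable : ComputableFunction₂ _∸_
∸-computable = binary (prim-computable (λ k xs → lookup xs zero ∸ k)
  (var zero) (pred-computable ⟪ var (suc zero) ⟫)
  (λ _ → refl) (λ k xs → pred[m∸n]≡m∸[1+n] (lookup xs zero) k) (var (suc zero)))

isZero : ℕ → ℕ
isZero zero = 1
isZero (suc _) = 0

isZero-computable : ComputableFunction isZero
isZero-computable = unary (prim-computable (λ k _ → isZero k)
  (suc-computable ⟪ computable-0 ⟫) computable-0
  (λ _ → refl) (λ _ _ → refl) (var zero))

isZero-%2 : ∀ k → isZero (k % 2) ≡ suc k % 2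
isZero-%2 zero = refl
isZero-%2 (suc zero) = refl
isZero-%2 (suc (suc k)) = isZero-%2 k

%2-computable : ComputableFunction (_% 2)
%2-computable = unary (prim-computable (λ k _ → k % 2)
  computable-0 (isZero-computable ⟪ var (suc zero) ⟫)
  (λ _ → refl) (λ k _ → isZero-%2 k) (var zero))

-- The half grows by one exactly when `k` is odd; this is the recursion step for computing `_/ 2`.
suc-/2 : ∀ k → k % 2 + k / 2 ≡ suc k / 2
suc-/2 zero = refl
suc-/2 (suc zero) = refl
suc-/2 (suc (suc k)) = begin
  k % 2 + suc (suc k) / 2  ≡⟨ cong (k % 2 +_) (m/n≡1+[m∸n]/n {suc (suc k)} {2} (s≤s (s≤s z≤n))) ⟩
  k % 2 + suc (k / 2)      ≡⟨ +-suc (k % 2) (k / 2) ⟩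
  suc (k % 2 + k / 2)      ≡⟨ cong suc (suc-/2 k) ⟩
  suc (suc k / 2)          ≡⟨ m/n≡1+[m∸n]/n {suc (suc (suc k))} {2} (s≤s (s≤s z≤n)) ⟨
  suc (suc (suc k)) / 2    ∎
  where open ≡-Reasoning

/2-computable : ComputableFunction (_/ 2)
/2-computable = unary (prim-computable (λ k _ → k / 2)
  computable-0 (+-computable ⟪ %2-computable ⟪ var zero ⟫ ∣ var (suc zero) ⟫)
  (λ _ → refl) (λ k _ → suc-/2 k) (var zero))

shift : ℕ → ℕ → ℕ
shift u i = _/_ u (2 ^ i) {{m^n≢0 2 i}}

shift-suc : ∀ u i → shift u i / 2 ≡ shift u (suc i)
shift-suc u i = trans (m/n/o≡m/[n*o] u (2 ^ i) 2) (/-congʳ (*-comm (2 ^ i) 2))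
  where instance
    _ = m^n≢0 2 i
    _ = m^n≢0 2 (suc i)
    _ = m*n≢0 (2 ^ i) 2

shift-computable : ComputableFunction₂ shift
shift-computable = binary (prim-computable (λ k xs → shift (lookup xs zero) k)
  (var zero) (/2-computable ⟪ var (suc zero) ⟫)
  (λ xs → sym (n/1≡n (lookup xs zero))) (λ k xs → shift-suc (lookup xs zero) k)
  (var (suc zero)))

-- `i ∈ D u` unfolds to `digit u i ≡ 1`, so proofs of either serve as the other.
digit : ℕ → ℕ → ℕ
digit u i = shift u i % 2

digit-computable : ComputableFunction₂ digit
digit-computable = binary (%2-computable ⟪ shift-computable ⟪ var zero ∣ var (suc zero) ⟫ ⟫)

digit≢0⇒∈D : ∀ u i → digit u i ≢ 0 → i ∈ D u
digit≢0⇒∈D u i d≢0 = ≤-antisym (≤-pred (m%n<n (shift u i) 2)) (n≢0⇒n>0 d≢0)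

-- Bounded sums as bounded existential quantifiers

∑< : ℕ → (ℕ → ℕ) → ℕ
∑< zero f = 0
∑< (suc k) f = f k + ∑< k f

∑<-computable : {G : Vec ℕ (suc n) → ℕ} {k : Vec ℕ n → ℕ} → Computable G → Computable k →
                Computable (λ xs → ∑< (k xs) (λ i → G (i ∷ xs)))
∑<-computable {G = G} g = prim-computable (λ k xs → ∑< k (λ i → G (i ∷ xs)))
  computable-0
  (+-computable ⟪ ∘-computable g (var zero ∷ᶜ rest) ∣ var (suc zero) ⟫)
  (λ _ → refl) (λ _ _ → refl)
  where
  rest : ComputableMap (λ xs → tail (tail xs))
  rest = reindexing-computable (λ i → suc (suc i)) λ { (_ ∷ _ ∷ _) _ → refl }

∑<≡0⇒≡0 : ∀ k {f i} → ∑< k f ≡ 0 → i < k → f i ≡ 0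
∑<≡0⇒≡0 (suc k) {f} {i} eq i<1+k with m<1+n⇒m<n∨m≡n i<1+k
... | inj₁ i<k  = ∑<≡0⇒≡0 k (m+n≡0⇒n≡0 (f k) eq) i<k
... | inj₂ refl = m+n≡0⇒m≡0 (f k) eq

∑<≢0⇒∃≢0 : ∀ k {f} → ∑< k f ≢ 0 → ∃[ i ] i < k × f i ≢ 0
∑<≢0⇒∃≢0 zero neq = contradiction refl neq
∑<≢0⇒∃≢0 (suc k) {f} neq with f k ≟ 0
... | no fk≢0 = k , ≤-refl , fk≢0
... | yes fk≡0 with ∑<≢0⇒∃≢0 k (λ eq → neq (cong₂ _+_ fk≡0 eq))
...   | i , i<k , fi≢0 = i , m<n⇒m<1+n i<k , fi≢0

-- Coding of pairs and the cylinder of a set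

triangular : ℕ → ℕ
triangular zero = 0
triangular (suc k) = suc (k + triangular k)

triangular-computable : ComputableFunction triangular
triangular-computable = unary (prim-computable (λ k _ → triangular k)
  computable-0 (suc-computable ⟪ +-computable ⟪ var zero ∣ var (suc zero) ⟫ ⟫)
  (λ _ → refl) (λ _ _ → refl) (var zero))

triangular-mono : ∀ {k l} → k ≤ l → triangular k ≤ triangular l
triangular-mono z≤n = z≤n
triangular-mono (s≤s k≤l) = s≤s (+-mono-≤ k≤l (triangular-mono k≤l))

-- Codes a pair (x , n) with n ≤ x; otherwise row does not recover x.
code : ℕ → ℕ → ℕ
code x n = triangular x + n

code-computable : ComputableFunction₂ code
code-computable =
  binary (+-computable ⟪ triangular-computable ⟪ var zero ⟫ ∣ var (suc zero) ⟫)

-- The difference vanishes iff `z < triangular (suc k)`, that is, iff `z` lies in or before the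
-- block from `triangular k` to `triangular k + k`. The value `k = z` always qualifies.
row-least : ∀ z → ∃ (IsLeastZero (λ k → suc z ∸ triangular (suc k)))
row-least z = least-zero _ z (m≤n⇒m∸n≡0 (s≤s (m≤m+n z (triangular z))))

row : ℕ → ℕ
row z = proj₁ (row-least z)

row-computable : ComputableFunction row
row-computable = unary {F = λ xs → row (lookup xs zero)} (μ-computable
  (∸-computable ⟪ suc-computable ⟪ var (suc zero) ⟫
                ∣ triangular-computable ⟪ suc-computable ⟪ var zero ⟫ ⟫ ⟫)
  (λ xs → proj₂ (row-least (lookup xs zero))))

row-code : ∀ x {n} → n ≤ x → row (code x n) ≡ x
row-code x {n} n≤x = least-zero-unique (proj₂ (row-least (code x n))) (at-x , below-x)
  where
  at-x : suc (code x n) ∸ triangular (suc x) ≡ 0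
  at-x = m≤n⇒m∸n≡0 (s≤s (≤-trans (+-monoʳ-≤ (triangular x) n≤x)
                                 (≤-reflexive (+-comm (triangular x) x))))
  below-x : ∀ {i} → i < x → suc (code x n) ∸ triangular (suc i) ≢ 0
  below-x i<x eq = <⇒≱ (s≤s (m≤m+n (triangular x) n))
    (≤-trans (m∸n≡0⇒m≤n eq) (triangular-mono i<x))

preimage-CE : {B : Pred ℕ 0ℓ} {f : ℕ → ℕ} →
              ComputableFunction f → CE B → CE (λ z → f z ∈ B)
preimage-CE {f = f} (r , p) (e , B⇔) = comp e (r ∷ []) , λ z → mk⇔
  (λ fz∈B → let y , q = to (B⇔ (f z)) fz∈B in y , ⇓comp (p z ∷ []) q)
  -- By determinism, the intermediate value in the halting computation is `f z`.
  λ { (y , ⇓comp (q ∷ []) q′) → from (B⇔ (f z))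
        (y , subst (λ w → e ⟨ w ∷ [] ⟩⇓ y) (⇓-deterministic q (p z)) q′) }
  where open Equivalence

-- The sparse reduction

module _ {B A : Pred ℕ 0ℓ} {h : ℕ → ℕ}
         (h-red : IsC₁Reduction (λ z → row z ∈ B) A h) where

  private
    h-computable = proj₁ (proj₁ h-red)
    h-reduces    = proj₂ (proj₁ h-red)
    h-disjoint   = proj₂ h-red

  digits-below : ℕ → ℕ → ℕ
  digits-below x n = ∑< x (digit (h (code x n)))

  ∃-digits-below≡0 : ∀ x → ∃[ n ] n ≤ x × digits-below x n ≡ 0
  -- The candidates are the columns `0` to `x`: one more than there are numbers below `x`, yet all
  -- still decoded correctly by `row`.
  ∃-digits-below≡0 x with any? {n = suc x} (λ i → digits-below x (toℕ i) ≟ 0)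
  ... | yes (i , eq) = toℕ i , ≤-pred (toℕ<n i) , eq
  ... | no none = ⊥-elim clash
    where
    element : (i : Fin (suc x)) → ∃[ j ] j < x × digit (h (code x (toℕ i))) j ≢ 0
    element i = ∑<≢0⇒∃≢0 x (λ eq → none (i , eq))

    hole : Fin (suc x) → Fin x
    hole i = fromℕ< (proj₁ (proj₂ (element i)))

    hole∈D : ∀ i → toℕ (hole i) ∈ D (h (code x (toℕ i)))
    hole∈D i with j , j<x , d≢0 ← element i =
      subst (_∈ D (h (code x (toℕ i)))) (sym (toℕ-fromℕ< j<x)) (digit≢0⇒∈D _ j d≢0)

    clash : ⊥
    -- Two columns share an element below `x`, although their codes differ and so their sets are
    -- disjoint.
    clash with i , i′ , i<i′ , same ← pigeonhole (n<1+n x) hole =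
      h-disjoint _ _ (λ eq → <⇒≢ i<i′ (+-cancelˡ-≡ (triangular x) _ _ eq)) (toℕ (hole i′))
        (subst (λ j → toℕ j ∈ D (h (code x (toℕ i)))) same (hole∈D i) , hole∈D i′)

  column-least : ∀ x → ∃ (IsLeastZero (digits-below x))
  column-least x = let n , _ , eq = ∃-digits-below≡0 x in least-zero _ n eq

  column : ℕ → ℕ
  column x = proj₁ (column-least x)

  -- Minimality puts `column x` at or before the column found by the pigeonhole argument. The bound
  -- guarantees that `row` recovers `x` from `code x (column x)`.
  column≤ : ∀ x → column x ≤ x
  column≤ x = let n , n≤x , eq = ∃-digits-below≡0 x in
    ≤-trans (≮⇒≥ (λ n<c → proj₂ (proj₂ (column-least x)) n<c eq)) n≤x

  column-computable : ComputableFunction column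
  column-computable = unary {F = λ xs → column (lookup xs zero)} (μ-computable
    (∑<-computable
      -- The variables are, in order, the summation index, the candidate column and `x`.
      (digit-computable ⟪ h-computable ⟪ code-computable ⟪ var (suc (suc zero)) ∣ var (suc zero) ⟫ ⟫
                        ∣ var zero ⟫)
      (var (suc zero)))
    (λ xs → proj₂ (column-least (lookup xs zero))))

  sparse : ℕ → ℕ
  sparse x = h (code x (column x))

  sparse-computable : ComputableFunction sparse
  sparse-computable = unary
    (h-computable ⟪ code-computable ⟪ var zero ∣ column-computable ⟪ var zero ⟫ ⟫ ⟫)

  row-code-column : ∀ x → row (code x (column x)) ≡ x
  row-code-column x = row-code x (column≤ x)

  -- Since `row` sends `code x (column x)` back to `x`, this code is in the cylinder iff `x ∈ B`,
  -- and distinct `x` have distinct codes.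
  sparse-reduction : IsC₁Reduction B A sparse
  sparse-reduction = (sparse-computable , reduces) , disjoint
    where
    reduces : ∀ x → x ∈ B ⇔ D (sparse x) ⊆ A
    reduces x = subst (λ w → w ∈ B ⇔ D (sparse x) ⊆ A) (row-code-column x) (h-reduces (code x (column x)))
    disjoint : ∀ x y → x ≢ y → Empty (D (sparse x) ∩ D (sparse y))
    disjoint x y x≢y = h-disjoint _ _ λ eq → x≢y
      (trans (sym (row-code-column x)) (trans (cong row eq) (row-code-column y)))

  -- For `y < x`, the digit at `y` is a summand of the vanishing sum `digits-below x (column x)`.
  ∈D-sparse⇒≤ : ∀ x {y} → y ∈ D (sparse x) → x ≤ y
  ∈D-sparse⇒≤ x y∈D = ≮⇒≥ λ y<x → 0≢1+n
    (trans (sym (∑<≡0⇒≡0 x (proj₁ (proj₂ (column-least x))) y<x)) y∈D)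

  -- Computability of the union

  range : Pred ℕ 0ℓ
  range = ⋃[ x ∶ ℕ ] D (sparse x)

  range-computable : ComputableSet range
  -- Applying `isZero` twice turns a count into a characteristic value: `0` stays `0`, anything else
  -- becomes `1`.
  range-computable = isZero ∘ isZero ∘ count
    , unary (isZero-computable ⟪ isZero-computable ⟪ count-computable ⟫ ⟫)
    , decide
    where
    count : ℕ → ℕ
    -- Only `x ≤ y` can have `y` in `D (sparse x)`, hence the bound `suc y`.
    count y = ∑< (suc y) (λ x → digit (sparse x) y)

    count-computable : Computable {1} (λ xs → count (lookup xs zero))
    count-computable = ∑<-computable
      (digit-computable ⟪ sparse-computable ⟪ var zero ⟫ ∣ var (suc zero) ⟫)
      (suc-computable ⟪ var zero ⟫)

    decide : ∀ y → (y ∈ range × isZero (isZero (count y)) ≡ 1)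
                 ⊎ (y ∉ range × isZero (isZero (count y)) ≡ 0)
    decide y with count y in eq
    ... | zero = inj₂ ((λ (x , y∈D) → 0≢1+n
      (trans (sym (∑<≡0⇒≡0 (suc y) eq (s≤s (∈D-sparse⇒≤ x y∈D)))) y∈D)) , refl)
    ... | suc _ with x , _ , d≢0 ← ∑<≢0⇒∃≢0 (suc y) (λ c≡0 → 0≢1+n (trans (sym c≡0) eq)) =
      inj₁ ((x , digit≢0⇒∈D (sparse x) y d≢0) , refl)

theorem4p3 : (A : Pred ℕ 0ℓ) → CE A → Complete _≤c₁_ A → Complete _≤c₁N_ A
theorem4p3 A _ complete B B-ce
  -- The cylinder of `B` appears as its preimage under `row`, which makes it c.e.
  with h , h-red ← complete (λ z → row z ∈ B) (preimage-CE row-computable B-ce) =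
  sparse h-red , sparse-reduction h-red , range-computable h-red
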